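{- For any partition $\lambda$, $$\tilde H_\lambda(x;q,t)=\sum_{C\in \mathcal C(\cdot,\lambda)} q^{\mathrm{betrayal}(C)}\, t^{\mathrm{cocharge}(C)}\, x^{\mathrm{shape}(C)},$$ where $\mathcal C(\cdot,\lambda)$ is the set of all circloids of weight $\lambda$ (of arbitrary shape) and $\tilde H_\lambda(x;q,t)$ is the modified Macdonald polynomial.
   Context: Compositions are finite sequences $\gamma=(\gamma_1,\gamma_2,\dots)$ of non-negative integers, identified when they differ only by trailing zeros; $|\gamma|=\sum_i\gamma_i$ and $x^\gamma=\prod_i x_i^{\gamma_i}$. For a partition $\lambda$, $\lambda'_c=\#\{r:\lambda_r\ge c\}$. Its shape is the set of cells $(r,c)$, $1\le c\le\lambda_r$, with row $r$ counted upward from the bottom and column $c$ from left to right. Modified Macdonald polynomial. A filling $F$ of shape $\lambda$ is an assignment of a positive integer $F_{(r,c)}$ to each cell of $\lambda$; its weight is the composition whose $i$-th entry is the number of $i$'s in $F$. Put $\mathrm{maj}(F)=\sum (\lambda'_c-r+1)$ over cells $(r,c)$, $r\ge2$, with $F_{(r,c)}>F_{(r-1,c)}$. An inversion triple of $F$ consists of two cells $(i,c),(i,c')$ with $c<c'$ of the same row, with entries $u=F_{(i,c)}$, $w=F_{(i,c')}$, and $v=F_{(i-1,c)}$ ($v=0$ if $i=1$), such that $u=v\neq w$, or $u>w>v$, or $w>v>u$, or $v>u>w$. $\mathrm{inv}(F)$ is the number of inversion triples. Then $$\tilde H_\lambda(x;q,t)=\sum_{F} q^{\mathrm{inv}(F)}t^{\mathrm{maj}(F)}x^{\mathrm{weight}(F)}$$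 over all fillings $F$ of shape $\lambda$. Circloids. A colored letter $x_y$ is a positive integer $x$ (the letter) with a positive integer subscript $y$ (the color). Prismatic order: $u_v>r_c$ iff $r<u$, or $r=u$ and $c>v$. A circloid $C$ of weight $\lambda$ and shape $\gamma$ (with $|\gamma|=|\lambda|$) is a placement of the colored letters $x_y$, $1\le y\le\lambda_x$, each used exactly once, on the perimeter of a circle subdivided into sectors $1,2,\dots$ read clockwise from a marked point $\star$, so that sector $s$ contains $\gamma_s$ colored letters and, read clockwise, the letters in each sector are in decreasing prismatic order. Cocharge. Let $w=w_1\cdots w_m$ be a permutation of $1,\dots,m$ written counter-clockwise on a circle with $\star$ between $w_1$ and $w_m$, so that clockwise from $\star$ one reads $w_m,\dots,w_1$. Label the letter $1$ with $0$; label $i$ with the label of $i-1$ if $\star$ is passed when reading clockwise from $i-1$ to $i$, and otherwise with the label of $i-1$ plus $1$. The cocharge is the sum of the labels. For a circloid $C$ of partition weight $\lambda$, let $C_i$ be the sub-configuration of colored letters with color $i$; its letters are $1,\dots,\lambda'_i$, each once. Then $\mathrm{cocharge}(C)=\sum_{i=1}^{\lambda_1}\mathrm{cocharge}(C_i)$. Betrayal. $\mathrm{betrayal}(C)=\sum_{i\ge1}\sum_j s_{i,j}$, where $j$ runs over the colors for which $i_j$ occurs in $C$ and $s_{i,j}$ is the number of colored letters $i_{k}$ with $k>j$ which are passed when reading clockwise from $(i-1)_j$ to $i_j$ in $C$, with the convention $0_j=\star$. -}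

module Defs where

open import Data.Bool.Base using (if_then_else_)
open import Data.List.Base
  using (List; []; _∷_; map; concat; filter; length; reverse; upTo;
         cartesianProductWith; cartesianProduct)
open import Data.List.Membership.Propositional using (_∈_)
open import Data.List.Membership.Propositional.Properties
  using (∈-cartesianProductWith⁺; ∈-cartesianProductWith⁻; ∈-filter⁺;
         ∈-filter⁻; ∈-map⁺; ∈-map⁻; ∈-upTo⁺; ∈-upTo⁻; ∈-concat⁺′)
open import Data.List.Properties using (∷-injective; ∷-injectiveˡ; ∷-injectiveʳ)
import Data.List.Properties as List
open import Data.List.Relation.Unary.All as All using (All; []; _∷_; all?)
open import Data.List.Relation.Unary.Any using (here)
open import Data.List.Relation.Unary.AllPairs as AllPairs using ([]; _∷_)
import Data.List.Relation.Unary.All.Properties as All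
import Data.List.Relation.Unary.AllPairs.Properties as AllPairs
open import Data.List.Relation.Binary.Disjoint.Propositional using (Disjoint)
open import Data.List.Relation.Unary.Linked using (Linked; linked?)
open import Data.List.Relation.Unary.Unique.Propositional using (Unique)
import Data.List.Relation.Unary.Unique.Propositional.Properties as Unique
open import Data.Nat.Base
  using (ℕ; zero; suc; pred; _+_; _∸_; _≤_; _<_; _>_; _≥_; z≤n; s≤s)
open import Data.Nat.ListAction using (sum)
open import Data.Nat.Properties using (_≟_; _<?_; _≤?_; suc-injective; ≮⇒≥)
open import Data.Product.Base using (_×_; _,_; ∃; proj₁; proj₂)
import Data.Product.Properties as Product
open import Data.Sum.Base using (_⊎_)
open import Function.Base using (_∘_)
open import Function.Bundles using (_⇔_; mk⇔)
open import Level using (Level)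
open import Relation.Binary.Definitions using (DecidableEquality)
open import Relation.Binary.PropositionalEquality
  using (_≡_; _≢_; refl; sym; trans; cong; cong₂)
open import Relation.Nullary.Decidable
  using (Dec; yes; no; does; ¬?; _×-dec_; _⊎-dec_)
open import Relation.Nullary.Negation using (contradiction)
open import Relation.Unary using (Pred; Decidable)

private
  variable
    a p : Level
    A : Set a

------------------------------------------------------------------------
-- Lists, indexed from 1

[1‥_] : ℕ → List ℕ
[1‥ n ] = map suc (upTo n)

-- The default value is returned at index 0 and past the end.
nth : A → List A → ℕ → A
nth d []       _             = d
nth d (x ∷ xs) 0             = d
nth d (x ∷ xs) 1             = x
nth d (x ∷ xs) (suc (suc i)) = nth d xs (suc i)

count : {P : Pred A p} → Decidable P → List A → ℕ
count P? xs = length (filter P? xs)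

∑ : List A → (A → ℕ) → ℕ
∑ xs f = sum (map f xs)

-- Position of the first occurrence, counted from 1.
position : DecidableEquality A → A → List A → ℕ
position _≟ᴬ_ x []       = 1
position _≟ᴬ_ x (y ∷ ys) =
  if does (x ≟ᴬ y) then 1 else suc (position _≟ᴬ_ x ys)

-- All lists of lists with entries in the given alphabet whose successive
-- members have the given lengths.
words : List A → ℕ → List (List A)
words as zero    = [] ∷ []
words as (suc n) = cartesianProductWith _∷_ as (words as n)

arrays : List A → List ℕ → List (List (List A))
arrays as []       = [] ∷ []
arrays as (n ∷ ns) = cartesianProductWith _∷_ (words as n) (arrays as ns)

------------------------------------------------------------------------
-- Compositions, partitions, power series

-- Two lists that differ by trailing zeros denote the same composition; the
-- i-th entry of γ is nth 0 γ i.
Composition : Set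
Composition = List ℕ

record Partition : Set where
  field
    parts      : List ℕ
    decreasing : Linked _≥_ parts
    positive   : All (0 <_) parts

open Partition public

conjugate : Partition → ℕ → ℕ
conjugate μ c = count (c ≤?_) (parts μ)

-- Cells (r , c) as (row , column).  The same pairs are the colored letters:
-- (x , y) is the letter x with color y, and the colored letters with
-- 1 ≤ y ≤ λ_x are the cells of λ.
Cell ColoredLetter : Set
Cell          = ℕ × ℕ
ColoredLetter = ℕ × ℕ

_≟ᶜ_ : DecidableEquality Cell
_≟ᶜ_ = Product.≡-dec _≟_ _≟_

row : Partition → ℕ → List Cell
row μ r = map (r ,_) [1‥ nth 0 (parts μ) r ]

cells : Partition → List Cell
cells μ = concat (map (row μ) [1‥ length (parts μ) ])

-- Formal power series in x₁, x₂, … over ℕ[q,t]: f γ i j is the coefficient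
-- of q^i t^j x^γ.
Series : Set
Series = Composition → ℕ → ℕ → ℕ

infix 4 _≋_
_≋_ : Series → Series → Set
f ≋ g = ∀ γ i j → f γ i j ≡ g γ i j

-- The coefficients of the sum of q^(f s) t^(g s) over the s in a list.
∑q^_t^_over_ : (A → ℕ) → (A → ℕ) → List A → ℕ → ℕ → ℕ
(∑q^ f t^ g over ss) i j = count (λ s → (f s ≟ i) ×-dec (g s ≟ j)) ss

------------------------------------------------------------------------
-- Fillings and the modified Macdonald polynomial

-- The list of rows, bottom row first.
Filling : Set
Filling = List (List ℕ)

-- Zero outside the shape, in particular in row 0.
entry : Filling → Cell → ℕ
entry F (r , c) = nth 0 (nth [] F r) c

weight : Filling → ℕ → ℕ
weight F i = count (i ≟_) (concat F)

record IsFilling (μ : Partition) (γ : Composition) (F : Filling) : Set where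
  constructor mkIsFilling
  field
    shape≡    : map length F ≡ parts μ
    positive  : All (All (0 <_)) F
    weight≡   : ∀ i → weight F (suc i) ≡ nth 0 γ (suc i)

IsDescent : Filling → Cell → Set
IsDescent F (r , c) = r ≥ 2 × entry F (r , c) > entry F (pred r , c)

isDescent? : ∀ F → Decidable (IsDescent F)
isDescent? F (r , c) = (2 ≤? r) ×-dec (entry F (pred r , c) <? entry F (r , c))

maj : Partition → Filling → ℕ
maj μ F = ∑ (filter (isDescent? F) (cells μ)) λ (r , c) → conjugate μ c + 1 ∸ r

IsInversion : (u v w : ℕ) → Set
IsInversion u v w =
  (u ≡ v × v ≢ w) ⊎ (u > w × w > v) ⊎ (w > v × v > u) ⊎ (v > u × u > w)

isInversion? : ∀ u v w → Dec (IsInversion u v w)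
isInversion? u v w =
  ((u ≟ v) ×-dec ¬? (v ≟ w)) ⊎-dec
  ((w <? u) ×-dec (v <? w)) ⊎-dec
  ((v <? w) ×-dec (u <? v)) ⊎-dec
  ((u <? v) ×-dec (w <? u))

-- The row below the first one has entries 0, which is the convention for v.
IsInversionTriple : Filling → Cell × Cell → Set
IsInversionTriple F ((i , c) , (i′ , c′)) =
  i ≡ i′ × c < c′ ×
  IsInversion (entry F (i , c)) (entry F (pred i , c)) (entry F (i , c′))

isInversionTriple? : ∀ F → Decidable (IsInversionTriple F)
isInversionTriple? F ((i , c) , (i′ , c′)) =
  (i ≟ i′) ×-dec (c <? c′) ×-dec isInversion? _ _ _

inv : Partition → Filling → ℕ
inv μ F = count (isInversionTriple? F) (cartesianProduct (cells μ) (cells μ))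

-- The fillings of shape μ and weight γ, each listed once (see ∈-fillings
-- and fillings-unique).  Their entries are at most length γ.
fillings : Partition → Composition → List Filling
fillings μ γ =
  filter (λ F → List.≡-dec _≟_ (map (weight F) [1‥ length γ ])
                               (map (nth 0 γ) [1‥ length γ ]))
         (arrays [1‥ length γ ] (parts μ))

H̃ : Partition → Series
H̃ μ γ = ∑q^ inv μ t^ maj μ over fillings μ γ

------------------------------------------------------------------------
-- Circloids

-- The sectors 1, …, length γ, clockwise from ⋆, each sector being read
-- clockwise; all later sectors are empty.
Placement : Set
Placement = List (List ColoredLetter)

-- The prismatic order.
_≻_ : ColoredLetter → ColoredLetter → Set
(u , v) ≻ (r , c) = r < u ⊎ (r ≡ u × c > v)

_≻?_ : ∀ z z′ → Dec (z ≻ z′)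
(u , v) ≻? (r , c) = (r <? u) ⊎-dec ((r ≟ u) ×-dec (v <? c))

record IsCircloid (μ : Partition) (γ : Composition) (C : Placement) : Set where
  constructor mkIsCircloid
  field
    shape≡     : map length C ≡ γ
    letters    : All (All (_∈ cells μ)) C
    once       : All (λ z → count (z ≟ᶜ_) (concat C) ≡ 1) (cells μ)
    decreasing : All (Linked _≻_) C

-- For points of a circle at the given clockwise distances from ⋆: x is
-- passed when reading clockwise from i to j.  The point ⋆ itself is 0.
Passed : (i x j : ℕ) → Set
Passed i x j = (i < x × x < j) ⊎ (j < i × (i < x ⊎ x < j))

passed? : ∀ i x j → Dec (Passed i x j)
passed? i x j =
  ((i <? x) ×-dec (x <? j)) ⊎-dec ((j <? i) ×-dec ((i <? x) ⊎-dec (x <? j)))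

-- The label of a letter in the permutation w = w₁⋯w_m.  Read clockwise from
-- ⋆, the circle is reverse w.
label : List ℕ → ℕ → ℕ
label w 0             = 0
label w 1             = 0
label w (suc (suc i)) =
  label w (suc i) +
  (if does (passed? (position _≟_ (suc i) (reverse w)) 0
                    (position _≟_ (suc (suc i)) (reverse w)))
   then 0 else 1)

cochargeʷ : List ℕ → ℕ
cochargeʷ w = ∑ w (label w)

-- The permutation formed by the letters of color i; concat C is the circle
-- read clockwise from ⋆, and permutations are written counter-clockwise.
colorWord : Placement → ℕ → List ℕ
colorWord C i = reverse (map proj₁ (filter (λ z → proj₂ z ≟ i) (concat C)))

cocharge : Partition → Placement → ℕ
cocharge μ C = ∑ [1‥ nth 0 (parts μ) 1 ] λ i → cochargeʷ (colorWord C i)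

-- With the convention that 0_j is ⋆.
positionIn : Placement → ColoredLetter → ℕ
positionIn C (zero  , j) = 0
positionIn C (suc i , j) = position _≟ᶜ_ (suc i , j) (concat C)

Betrays : Placement → ColoredLetter → ColoredLetter → Set
Betrays C (i , j) (i′ , k) =
  i′ ≡ i × k > j ×
  Passed (positionIn C (pred i , j)) (positionIn C (i′ , k)) (positionIn C (i , j))

betrays? : ∀ C z → Decidable (Betrays C z)
betrays? C (i , j) (i′ , k) = (i′ ≟ i) ×-dec (j <? k) ×-dec passed? _ _ _

betrayal : Placement → ℕ
betrayal C = ∑ (concat C) λ z → count (betrays? C z) (concat C)

-- The circloids of weight μ and shape γ, each listed once (see ∈-circloids
-- and circloids-unique).
circloids : Partition → Composition → List Placement
circloids μ γ =
  filter (λ C → all? (λ z → count (z ≟ᶜ_) (concat C) ≟ 1) (cells μ) ×-dec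
                all? (linked? _≻?_) C)
         (arrays (cells μ) γ)

circloidSeries : Partition → Series
circloidSeries μ γ = ∑q^ betrayal t^ cocharge μ over circloids μ γ

------------------------------------------------------------------------
-- Correctness of the enumerations

∈-words⁺ : ∀ {as xs} n → length {A = A} xs ≡ n → All (_∈ as) xs → xs ∈ words as n
∈-words⁺ zero    refl []       = here refl
∈-words⁺ (suc n) eq   (p ∷ ps) =
  ∈-cartesianProductWith⁺ _∷_ p (∈-words⁺ n (suc-injective eq) ps)

∈-words⁻ : ∀ {as xs} n → xs ∈ words {A = A} as n → length xs ≡ n × All (_∈ as) xs
∈-words⁻ zero (here refl) = refl , []
∈-words⁻ {as = as} (suc n) xs∈
  with _ , _ , p , q , refl ← ∈-cartesianProductWith⁻ _∷_ as (words as n) xs∈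
  with eq , ps ← ∈-words⁻ n q = cong suc eq , p ∷ ps

∈-arrays⁺ : ∀ {as xss} ns → map (length {A = A}) xss ≡ ns →
            All (All (_∈ as)) xss → xss ∈ arrays as ns
∈-arrays⁺ []       refl []       = here refl
∈-arrays⁺ (n ∷ ns) eq   (p ∷ ps) =
  ∈-cartesianProductWith⁺ _∷_ (∈-words⁺ n (∷-injectiveˡ eq) p)
                              (∈-arrays⁺ ns (∷-injectiveʳ eq) ps)

∈-arrays⁻ : ∀ {as xss} ns → xss ∈ arrays {A = A} as ns →
            map length xss ≡ ns × All (All (_∈ as)) xss
∈-arrays⁻ [] (here refl) = refl , []
∈-arrays⁻ {as = as} (n ∷ ns) xss∈
  with _ , _ , p , q , refl ←
    ∈-cartesianProductWith⁻ _∷_ (words as n) (arrays as ns) xss∈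
  with eq , r ← ∈-words⁻ n p | eqs , rs ← ∈-arrays⁻ ns q =
  cong₂ _∷_ eq eqs , r ∷ rs

words-unique : ∀ {as} → Unique as → ∀ n → Unique (words {A = A} as n)
words-unique u zero    = [] ∷ []
words-unique u (suc n) =
  Unique.cartesianProductWith⁺ _∷_ ∷-injective u (words-unique u n)

arrays-unique : ∀ {as} → Unique as → ∀ ns → Unique (arrays {A = A} as ns)
arrays-unique u []       = [] ∷ []
arrays-unique u (n ∷ ns) =
  Unique.cartesianProductWith⁺ _∷_ ∷-injective (words-unique u n) (arrays-unique u ns)

[1‥]-unique : ∀ n → Unique [1‥ n ]
[1‥]-unique n = Unique.map⁺ suc-injective (Unique.upTo⁺ n)

∈-[1‥]⁺ : ∀ {i n} → i < n → suc i ∈ [1‥ n ]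
∈-[1‥]⁺ i<n = ∈-map⁺ suc (∈-upTo⁺ i<n)

∈-[1‥]⁻ : ∀ {i n} → i ∈ [1‥ n ] → 1 ≤ i × i ≤ n
∈-[1‥]⁻ i∈ with _ , p , refl ← ∈-map⁻ suc i∈ = s≤s z≤n , ∈-upTo⁻ p

cells-unique : ∀ μ → Unique (cells μ)
cells-unique μ = Unique.concat⁺
  (All.map⁺ (All.universal (λ r → Unique.map⁺ Product.,-injectiveʳ ([1‥]-unique _)) _))
  (AllPairs.map⁺ (AllPairs.map disjoint ([1‥]-unique (length (parts μ)))))
  where
  disjoint : ∀ {r s} → r ≢ s → Disjoint (row μ r) (row μ s)
  disjoint r≢s (p , q)
    with _ , _ , refl ← ∈-map⁻ (_ ,_) p | _ , _ , refl ← ∈-map⁻ (_ ,_) q = r≢s refl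

nth-past : ∀ {d : A} xs i → length xs ≤ i → nth d xs (suc i) ≡ d
nth-past []       i       _         = refl
nth-past (x ∷ xs) (suc i) (s≤s len≤) = nth-past xs i len≤

map-≡-local : ∀ {f g : A → ℕ} {xs} → map f xs ≡ map g xs → All (λ x → f x ≡ g x) xs
map-≡-local {xs = []}     _  = []
map-≡-local {xs = x ∷ xs} eq = ∷-injectiveˡ eq ∷ map-≡-local (∷-injectiveʳ eq)

∈⇒weight≢0 : ∀ {F i} → i ∈ concat F → weight F i ≢ 0
∈⇒weight≢0 {F} {i} i∈ eq
  with filter (i ≟_) (concat F) | ∈-filter⁺ (i ≟_) i∈ refl
... | _ ∷ _ | _ = contradiction eq λ ()

∈-fillings : ∀ {μ γ F} → F ∈ fillings μ γ ⇔ IsFilling μ γ F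
∈-fillings {μ} {γ} {F} = mk⇔ to from
  where
  n = length γ

  to : F ∈ fillings μ γ → IsFilling μ γ F
  to F∈
    with F∈arrays , eq ← ∈-filter⁻ _ {xs = arrays [1‥ n ] (parts μ)} F∈
    with shape≡ , entries ← ∈-arrays⁻ (parts μ) F∈arrays =
    mkIsFilling shape≡ (All.map (All.map (proj₁ ∘ ∈-[1‥]⁻)) entries) weight≡
    where
    weight≡ : ∀ i → weight F (suc i) ≡ nth 0 γ (suc i)
    weight≡ i with i <? n
    ... | yes i<n = All.lookup (map-≡-local eq) (∈-[1‥]⁺ i<n)
    ... | no  i≮n = trans
      (cong length (List.filter-none (suc i ≟_)
        (All.concat⁺ (All.map (All.map λ { j∈ refl → i≮n (proj₂ (∈-[1‥]⁻ j∈)) })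
                              entries))))
      (sym (nth-past γ i (≮⇒≥ i≮n)))

  from : IsFilling μ γ F → F ∈ fillings μ γ
  from (mkIsFilling shape≡ pos weight≡) = ∈-filter⁺ _
    (∈-arrays⁺ (parts μ) shape≡
      (All.tabulate λ row∈ → All.tabulate λ j∈ →
        entry∈ (∈-concat⁺′ j∈ row∈) (All.lookup (All.lookup pos row∈) j∈)))
    (List.map-cong-local (All.tabulate λ i∈ → onLetters (∈-map⁻ suc i∈)))
    where
    onLetters : ∀ {j} → ∃ (λ i → i ∈ upTo n × j ≡ suc i) → weight F j ≡ nth 0 γ j
    onLetters (i , _ , refl) = weight≡ i

    entry∈ : ∀ {j} → j ∈ concat F → 0 < j → j ∈ [1‥ n ]
    entry∈ {suc i} j∈ _ with i <? n
    ... | yes i<n = ∈-[1‥]⁺ i<n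
    ... | no  i≮n = contradiction
      (trans (weight≡ i) (nth-past γ i (≮⇒≥ i≮n))) (∈⇒weight≢0 {F} j∈)

fillings-unique : ∀ μ γ → Unique (fillings μ γ)
fillings-unique μ γ =
  Unique.filter⁺ _ (arrays-unique ([1‥]-unique (length γ)) (parts μ))

∈-circloids : ∀ {μ γ C} → C ∈ circloids μ γ ⇔ IsCircloid μ γ C
∈-circloids {μ} {γ} {C} = mk⇔ to from
  where
  to : C ∈ circloids μ γ → IsCircloid μ γ C
  to C∈
    with C∈arrays , once , decr ← ∈-filter⁻ _ {xs = arrays (cells μ) γ} C∈
    with shape≡ , letters ← ∈-arrays⁻ γ C∈arrays =
    mkIsCircloid shape≡ letters once decr

  from : IsCircloid μ γ C → C ∈ circloids μ γ
  from (mkIsCircloid shape≡ letters once decr) =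
    ∈-filter⁺ _ (∈-arrays⁺ γ shape≡ letters) (once , decr)

circloids-unique : ∀ μ γ → Unique (circloids μ γ)
circloids-unique μ γ = Unique.filter⁺ _ (arrays-unique (cells-unique μ) γ)

{-# OPTIONS --safe #-}

-- A filling F corresponds to the circloid C in which the colored letter r_c
-- lies in the sector F(r,c); the order inside the sectors is then forced, and
-- C reads clockwise from ⋆ the cells in the lexicographic order of entries,
-- ties being broken by the prismatic order.  The statistics agree term by
-- term: (r,c) is a descent iff r_c comes after (r-1)_c, i.e. iff ⋆ is not
-- passed, so it raises by one the labels of the letters r, …, λ'_c of color c;
-- and (i,j), (i,k) with j < k form an inversion triple iff i_k is passed
-- from (i-1)_j to i_j.

module Submission where

open import Defs
open import Data.Bool.Base using (true; false; if_then_else_)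
open import Data.List.Base
  using (List; []; _∷_; _++_; map; concat; filter; length; reverse; upTo;
         applyUpTo; applyDownFrom; cartesianProduct)
open import Data.List.Membership.DecPropositional _≟ᶜ_ using (_∈?_)
open import Data.List.Membership.Propositional using (_∈_; _∉_)
open import Data.List.Membership.Propositional.Properties
open import Data.List.Membership.Propositional.Properties.WithK using (unique∧set⇒bag)
open import Data.List.Properties
  using (map-∘; map-++; map-cong-local; map-cong; map-id-local; map-applyUpTo;
         map-upTo; reverse-involutive;
         concat-map; length-++; length-map; length-applyUpTo; filter-++;
         filter-all; filter-none; filter-accept; filter-reject; ∷-injectiveˡ;
         ∷-injectiveʳ)
open import Data.List.Relation.Binary.BagAndSetEquality using (∼bag⇒↭)
open import Data.List.Relation.Binary.Permutation.Propositional as ↭ using (_↭_)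
import Data.List.Relation.Binary.Permutation.Propositional.Properties as ↭
open import Data.List.Relation.Unary.All as All using (All; []; _∷_)
import Data.List.Relation.Unary.All.Properties as All
open import Data.List.Relation.Unary.AllPairs as AllPairs using (AllPairs; []; _∷_)
import Data.List.Relation.Unary.AllPairs.Properties as AllPairs
open import Data.List.Relation.Unary.Any using (here; there)
open import Data.List.Relation.Unary.Linked as Linked using (Linked; []; _∷_)
import Data.List.Relation.Unary.Linked.Properties as Linked
open import Data.List.Relation.Unary.Unique.Propositional using (Unique)
import Data.List.Relation.Unary.Unique.Propositional.Properties as Unique
open import Data.Nat.Base
open import Data.Nat.ListAction using (sum)
open import Data.Nat.ListAction.Properties using (sum-++; sum-↭)
open import Data.Nat.Properties
open import Data.Product.Base using (_×_; _,_; ∃; proj₁; proj₂)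
open import Data.Product.Properties using (,-injectiveˡ)
open import Data.Sum.Base using (_⊎_; inj₁; inj₂)
open import Function.Base using (_∘_; id)
open import Function.Bundles using (_⇔_; mk⇔; Equivalence)
open import Level using (Level)
open import Relation.Binary.Core using (Rel)
open import Relation.Binary.Definitions
  using (DecidableEquality; Asymmetric; tri<; tri≈; tri>)
open import Relation.Binary.PropositionalEquality
open import Relation.Nullary.Decidable
  using (Dec; yes; no; does; dec-true; dec-false; does-⇔; _×-dec_)
open import Relation.Nullary.Negation using (¬_; contradiction)
open import Relation.Unary using (Pred; Decidable)

open Equivalence using (to; from)

-- The tie rule carries the argument. For `j < k`, equal entries are read in the order i_j, i_k,
-- (i-1)_j, so the entries `u`, `w`, `v` of a triple turn into three distinct points. The inversion
-- patterns then become the three linear orders in which `w` lies on the clockwise arc from `v` to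
-- `u`, and the pattern u = v ≠ w is absorbed into u < v. In a column the same rule puts r_c before
-- (r-1)_c on a tie, so equality is not a descent. In the bottom row `v` = 0 lies below all entries
-- just as ⋆, at position 0, lies before all letters.
--
-- Fillings and circloids are linked by the relation `InSectors (entry F) 1 C` instead of two
-- mutually inverse functions. The statistics are compared for an arbitrary related pair, however it
-- was built; what remains is that every object has a partner and is determined by it.

private
  variable
    a b p r : Level
    A : Set a
    B : Set b

-- Sums and counts

∑-cong : ∀ {f g : A → ℕ} xs → (∀ {x} → x ∈ xs → f x ≡ g x) →
         sum (map f xs) ≡ sum (map g xs)
∑-cong xs eq = cong sum (map-cong-local (All.tabulate eq))

∑-↭ : ∀ (f : A → ℕ) {xs ys} → xs ↭ ys → sum (map f xs) ≡ sum (map f ys)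
∑-↭ f = sum-↭ ∘ ↭.map⁺ f

∑-map : ∀ (f : B → ℕ) (g : A → B) xs →
        sum (map f (map g xs)) ≡ sum (map (f ∘ g) xs)
∑-map f g xs = cong sum (sym (map-∘ xs))

∑-++ : ∀ (f : A → ℕ) xs ys →
       sum (map f (xs ++ ys)) ≡ sum (map f xs) + sum (map f ys)
∑-++ f xs ys = trans (cong sum (map-++ f xs ys)) (sum-++ (map f xs) (map f ys))

∑-concat : ∀ (f : A → ℕ) xss →
           sum (map f (concat xss)) ≡ sum (map (λ xs → sum (map f xs)) xss)
∑-concat f []         = refl
∑-concat f (xs ∷ xss) =
  trans (∑-++ f xs (concat xss)) (cong (sum (map f xs) +_) (∑-concat f xss))

∑-cartesianProduct : ∀ (f : A × B → ℕ) xs ys →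
  sum (map f (cartesianProduct xs ys)) ≡
  sum (map (λ x → sum (map (λ y → f (x , y)) ys)) xs)
∑-cartesianProduct f []       ys = refl
∑-cartesianProduct f (x ∷ xs) ys = trans
  (∑-++ f (map (x ,_) ys) (cartesianProduct xs ys))
  (cong₂ _+_ (∑-map f (x ,_) ys) (∑-cartesianProduct f xs ys))

χ : Dec A → ℕ
χ p? = if does p? then 1 else 0

∑-filter : ∀ {P : Pred A p} (P? : Decidable P) (f : A → ℕ) xs →
           sum (map f (filter P? xs)) ≡ sum (map (λ x → χ (P? x) * f x) xs)
∑-filter P? f []       = refl
∑-filter P? f (x ∷ xs) with does (P? x)
... | false = ∑-filter P? f xs
... | true  = cong₂ _+_ (sym (*-identityˡ (f x))) (∑-filter P? f xs)

count≡∑ : ∀ {P : Pred A p} (P? : Decidable P) xs →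
          count P? xs ≡ sum (map (λ x → χ (P? x)) xs)
count≡∑ P? []       = refl
count≡∑ P? (x ∷ xs) with does (P? x)
... | false = count≡∑ P? xs
... | true  = cong suc (count≡∑ P? xs)

if-not : (p? : Dec A) (q? : Dec B) → (B → ¬ A) → (¬ B → A) →
         (if does p? then 0 else 1) ≡ χ q?
if-not p? (yes q) q⇒¬p _ = cong (if_then 0 else 1) (dec-false p? (q⇒¬p q))
if-not p? (no ¬q) _ ¬q⇒p = cong (if_then 0 else 1) (dec-true p? (¬q⇒p ¬q))

χ-cong : A ⇔ B → (p? : Dec A) (q? : Dec B) → χ p? ≡ χ q?
χ-cong eq p? q? = cong (if_then 1 else 0) (does-⇔ eq p? q?)

count-++ : ∀ {P : Pred A p} (P? : Decidable P) xs ys →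
           count P? (xs ++ ys) ≡ count P? xs + count P? ys
count-++ P? xs ys =
  trans (cong length (filter-++ P? xs ys)) (length-++ (filter P? xs))

count-all : ∀ {P : Pred A p} (P? : Decidable P) {xs} → All P xs → count P? xs ≡ length xs
count-all P? = cong length ∘ filter-all P?

count-none : ∀ {P : Pred A p} (P? : Decidable P) {xs} → All (¬_ ∘ P) xs → count P? xs ≡ 0
count-none P? = cong length ∘ filter-none P?

-- Summation by parts.
∑-partial-sums : ∀ (ℓ δ : ℕ → ℕ) a m → ℓ 0 ≡ a + δ 0 →
  (∀ i → ℓ (suc i) ≡ ℓ i + δ (suc i)) →
  sum (applyUpTo ℓ m) ≡ m * a + sum (applyUpTo (λ i → δ i * (m ∸ i)) m)
∑-partial-sums ℓ δ a zero    _  _  = refl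
∑-partial-sums ℓ δ a (suc m) ℓ₀ ℓ₊ = begin
  ℓ 0 + sum (applyUpTo (ℓ ∘ suc) m)
    -- The shifted sequence starts from `ℓ 0`, so the induction needs an arbitrary initial value
    -- `a`; the application to labels takes 0.
    ≡⟨ cong (ℓ 0 +_) (∑-partial-sums (ℓ ∘ suc) (δ ∘ suc) (ℓ 0) m (ℓ₊ 0) (ℓ₊ ∘ suc)) ⟩
  ℓ 0 + (m * ℓ 0 + S)
    ≡⟨ +-assoc (ℓ 0) (m * ℓ 0) S ⟨
  suc m * ℓ 0 + S
    ≡⟨ cong (λ k → suc m * k + S) ℓ₀ ⟩
  suc m * (a + δ 0) + S
    ≡⟨ cong (_+ S) (trans (*-distribˡ-+ (suc m) a (δ 0)) (cong (suc m * a +_) (*-comm (suc m) (δ 0)))) ⟩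
  suc m * a + δ 0 * suc m + S
    ≡⟨ +-assoc (suc m * a) (δ 0 * suc m) S ⟩
  suc m * a + (δ 0 * suc m + S) ∎
  where
  open ≡-Reasoning
  S = sum (applyUpTo (λ i → δ (suc i) * (m ∸ i)) m)

-- Duplicate-free and sorted lists

unique-↭ : ∀ {xs ys : List A} → Unique xs → Unique ys →
           (∀ {x} → x ∈ xs → x ∈ ys) → (∀ {x} → x ∈ ys → x ∈ xs) → xs ↭ ys
unique-↭ u v ⊆ ⊇ = ∼bag⇒↭ (unique∧set⇒bag u v (mk⇔ ⊆ ⊇))

module _ (_~_ : A → B → Set r) where

  -- Pigeonhole: the partner of the head is cut out of `ys`, and the tail is matched with what is
  -- left. Injectivity is asked only of members, because it comes from facts that hold for
  -- enumerated fillings and circloids.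
  length-≤ : ∀ {xs ys} → Unique xs →
             (∀ {x} → x ∈ xs → ∃ λ y → y ∈ ys × x ~ y) →
             (∀ {x x′ y} → x ∈ xs → x′ ∈ xs → y ∈ ys → x ~ y → x′ ~ y → x ≡ x′) →
             length xs ≤ length ys
  length-≤ {[]}     _          _     _   = z≤n
  length-≤ {x ∷ xs} (x∉ ∷ uxs) image inj
    with y , y∈ys , x~y ← image (here refl)
    with ys₁ , ys₂ , refl ← ∈-∃++ y∈ys
    = subst (suc (length xs) ≤_) (sym (↭.↭-length (↭.shift y ys₁ ys₂)))
        (s≤s (length-≤ uxs image′
          λ x∈ x′∈ z∈ → inj (there x∈) (there x′∈) (weaken z∈)))
    where
    weaken : ∀ {z} → z ∈ ys₁ ++ ys₂ → z ∈ ys₁ ++ y ∷ ys₂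
    weaken = ↭.∈-resp-↭ (↭.↭-sym (↭.shift y ys₁ ys₂)) ∘ there

    image′ : ∀ {x′} → x′ ∈ xs → ∃ λ z → z ∈ ys₁ ++ ys₂ × x′ ~ z
    image′ {x′} x′∈
      with z , z∈ , x′~z ← image (there x′∈)
      with ↭.∈-resp-↭ (↭.shift y ys₁ ys₂) z∈
    -- A second element with the partner `y` would equal the head, against uniqueness; hence every
    -- partner of the tail survives the removal of `y`.
    ... | here refl = contradiction (inj (here refl) (there x′∈) z∈ x~y x′~z)
                                    (All.lookup x∉ x′∈)
    ... | there z∈′ = z , z∈′ , x′~z

count≡1⇒unique : (_≟ᴬ_ : DecidableEquality A) (xs : List A) →
                 (∀ {z} → z ∈ xs → count (z ≟ᴬ_) xs ≡ 1) → Unique xs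
count≡1⇒unique _≟ᴬ_ []       _    = []
count≡1⇒unique _≟ᴬ_ (x ∷ xs) once =
  All.tabulate x≢ ∷ count≡1⇒unique _≟ᴬ_ xs λ z∈ →
    trans (sym (cong length (filter-reject (_ ≟ᴬ_) (x≢ z∈ ∘ sym)))) (once (there z∈))
  where
  x≢ : ∀ {y} → y ∈ xs → x ≢ y
  x≢ y∈ refl
    with filter (x ≟ᴬ_) xs | ∈-filter⁺ (x ≟ᴬ_) y∈ refl
       | trans (sym (cong length (filter-accept (x ≟ᴬ_) {x} {xs} refl))) (once (here refl))
  ... | _ ∷ _ | _ | ()

unique⇒count≡1 : (_≟ᴬ_ : DecidableEquality A) {xs : List A} → Unique xs →
                 ∀ {z} → z ∈ xs → count (z ≟ᴬ_) xs ≡ 1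
unique⇒count≡1 _≟ᴬ_ (x∉ ∷ _) (here refl) =
  trans (cong length (filter-accept (_ ≟ᴬ_) refl)) (cong suc (count-none (_ ≟ᴬ_) x∉))
unique⇒count≡1 _≟ᴬ_ (x∉ ∷ u) (there z∈) =
  trans (cong length (filter-reject (_ ≟ᴬ_) (All.lookup x∉ z∈ ∘ sym))) (unique⇒count≡1 _≟ᴬ_ u z∈)

position>0 : (_≟ᴬ_ : DecidableEquality A) → ∀ x xs → 0 < position _≟ᴬ_ x xs
position>0 _≟ᴬ_ x []       = s≤s z≤n
position>0 _≟ᴬ_ x (y ∷ ys) with does (x ≟ᴬ y)
... | true  = s≤s z≤n
... | false = s≤s z≤n

module _ {_<ᴬ_ : Rel A r} (asym : Asymmetric _<ᴬ_) where

  sorted-unique : ∀ {xs} → AllPairs _<ᴬ_ xs → Unique xs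
  sorted-unique = AllPairs.map λ { x<y refl → asym x<y x<y }

  -- Each head precedes the rest of its list, so two different heads would precede each other.
  -- Asymmetry also keeps a head out of its own tail, hence removing the common head leaves tails
  -- with the same members.
  sorted-≡ : ∀ {xs ys} → AllPairs _<ᴬ_ xs → AllPairs _<ᴬ_ ys →
             (∀ {x} → x ∈ xs → x ∈ ys) → (∀ {x} → x ∈ ys → x ∈ xs) → xs ≡ ys
  sorted-≡ [] [] _ _ = refl
  sorted-≡ [] (_ ∷ _) _ ⊇ = contradiction (⊇ (here refl)) λ ()
  sorted-≡ (_ ∷ _) [] ⊆ _ = contradiction (⊆ (here refl)) λ ()
  sorted-≡ {x ∷ xs} {y ∷ ys} (x< ∷ s) (y< ∷ t) ⊆ ⊇ =
    cong₂ _∷_ x≡y (sorted-≡ s t (λ z∈ → tail x< x≡y (⊆ (there z∈)) z∈)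
                                (λ z∈ → tail y< (sym x≡y) (⊇ (there z∈)) z∈))
    where
    heads : x ∈ y ∷ ys → y ∈ x ∷ xs → x ≡ y
    heads (here x≡y) _          = x≡y
    heads (there _)  (here y≡x) = sym y≡x
    heads (there x∈) (there y∈) =
      contradiction (All.lookup x< y∈) (asym (All.lookup y< x∈))

    x≡y = heads (⊆ (here refl)) (⊇ (here refl))

    tail : ∀ {u v us vs z} → All (u <ᴬ_) us → u ≡ v → z ∈ v ∷ vs → z ∈ us → z ∈ vs
    tail u< refl (here refl) z∈ = contradiction (All.lookup u< z∈) (λ z<z → asym z<z z<z)
    tail u< _    (there z∈)  _  = z∈

  -- With `position>0`, this is all that the comparison of statistics uses about positions on the
  -- circle.
  position-mono : (_≟ᴬ_ : DecidableEquality A) → ∀ {xs x y} → AllPairs _<ᴬ_ xs →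
                  x ∈ xs → y ∈ xs → x <ᴬ y → position _≟ᴬ_ x xs < position _≟ᴬ_ y xs
  position-mono _≟ᴬ_ {z ∷ xs} {x} {y} (z< ∷ s) x∈ y∈ x<y with x ≟ᴬ z | y ≟ᴬ z
  ... | yes refl | yes refl = contradiction x<y (asym x<y)
  ... | yes refl | no  _    = s≤s (position>0 _≟ᴬ_ y xs)
  position-mono _≟ᴬ_ (z< ∷ s) (here refl) _ x<y | no x≢z | yes refl = contradiction refl x≢z
  position-mono _≟ᴬ_ (z< ∷ s) (there x∈) _ x<y | no _ | yes refl =
    contradiction x<y (asym (All.lookup z< x∈))
  position-mono _≟ᴬ_ (z< ∷ s) (here refl) _ _ | no x≢z | no _ = contradiction refl x≢z
  position-mono _≟ᴬ_ (z< ∷ s) (there _) (here refl) _ | no _ | no y≢z = contradiction refl y≢z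
  position-mono _≟ᴬ_ (z< ∷ s) (there x∈) (there y∈) x<y | no _ | no _ =
    s≤s (position-mono _≟ᴬ_ s x∈ y∈ x<y)

++-injective : ∀ (us vs : List A) {us′ vs′} → length us ≡ length vs →
               us ++ us′ ≡ vs ++ vs′ → us ≡ vs × us′ ≡ vs′
++-injective []       []       _   eq = refl , eq
++-injective (u ∷ us) (v ∷ vs) len eq
  with eq₁ , eq₂ ← ++-injective us vs (suc-injective len) (∷-injectiveʳ eq) =
  cong₂ _∷_ (∷-injectiveˡ eq) eq₁ , eq₂

-- The lengths fix the places where the word is cut; for circloids they are the shape.
concat-injective : ∀ (xss yss : List (List A)) → map length xss ≡ map length yss →
                   concat xss ≡ concat yss → xss ≡ yss
concat-injective []         []         _   _  = refl
concat-injective (xs ∷ xss) (ys ∷ yss) len eq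
  with eq₁ , eq₂ ← ++-injective xs ys (∷-injectiveˡ len) eq =
  cong₂ _∷_ eq₁ (concat-injective xss yss (∷-injectiveʳ len) eq₂)

-- Lists indexed from 1

map-[1‥] : ∀ (f : ℕ → A) n → map f [1‥ n ] ≡ applyUpTo (f ∘ suc) n
map-[1‥] f n = trans (cong (map f) (map-upTo suc n)) (map-applyUpTo suc f n)

nth-applyUpTo : ∀ (d : A) f {n i} → i < n → nth d (applyUpTo f n) (suc i) ≡ f i
nth-applyUpTo d f {i = zero}  (s≤s _)   = refl
nth-applyUpTo d f {i = suc i} (s≤s i<n) = nth-applyUpTo d (f ∘ suc) i<n

nth-map-[1‥] : ∀ (d : A) f {n i} → i < n → nth d (map f [1‥ n ]) (suc i) ≡ f (suc i)
nth-map-[1‥] d f {n} {i} i<n =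
  trans (cong (λ xs → nth d xs (suc i)) (map-[1‥] f n)) (nth-applyUpTo d (f ∘ suc) i<n)

applyUpTo-nth : ∀ (d : A) xs → applyUpTo (nth d xs ∘ suc) (length xs) ≡ xs
applyUpTo-nth d []       = refl
applyUpTo-nth d (x ∷ xs) = cong (x ∷_) (applyUpTo-nth d xs)

map-nth : ∀ (d : A) xs → map (nth d xs) [1‥ length xs ] ≡ xs
map-nth d xs = trans (map-[1‥] (nth d xs) (length xs)) (applyUpTo-nth d xs)

nth-map : ∀ (f : A → B) d xs i → nth (f d) (map f xs) i ≡ f (nth d xs i)
nth-map f d []       i             = refl
nth-map f d (x ∷ xs) 0             = refl
nth-map f d (x ∷ xs) 1             = refl
nth-map f d (x ∷ xs) (suc (suc i)) = nth-map f d xs (suc i)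

nth-0 : ∀ (d : A) xs → nth d xs 0 ≡ d
nth-0 d []       = refl
nth-0 d (x ∷ xs) = refl

-- Cells of a partition

-- Since the parts decrease, those that are at least `suc c` form an initial segment, so their
-- number reaches `suc r` exactly if the part with index `suc r` belongs to it.
conjugate-⇔ : ∀ ps → Linked _≥_ ps → ∀ c r →
              (suc c ≤ nth 0 ps (suc r)) ⇔ (suc r ≤ count (suc c ≤?_) ps)
conjugate-⇔ ps₀ decr c = go ps₀ (Linked.Linked⇒AllPairs (λ i≥j j≥k → ≤-trans j≥k i≥j) decr)
  where
  go : ∀ ps → AllPairs _≥_ ps → ∀ r →
       (suc c ≤ nth 0 ps (suc r)) ⇔ (suc r ≤ count (suc c ≤?_) ps)
  go []       _        r = mk⇔ (λ ()) (λ ())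
  go (p ∷ ps) (p≥ ∷ s) r with suc c ≤? p
  ... | yes c<p rewrite filter-accept (suc c ≤?_) {p} {ps} c<p = accept r
    where
    accept : ∀ r → (suc c ≤ nth 0 (p ∷ ps) (suc r)) ⇔ (suc r ≤ suc (count (suc c ≤?_) ps))
    accept zero    = mk⇔ (λ _ → s≤s z≤n) (λ _ → c<p)
    accept (suc r) = mk⇔ (s≤s ∘ to (go ps s r)) (λ { (s≤s q) → from (go ps s r) q })
  ... | no  c≮p rewrite filter-reject (suc c ≤?_) {p} {ps} c≮p = mk⇔ (reject r) none
    where
    count≡0 : count (suc c ≤?_) ps ≡ 0
    count≡0 = count-none (suc c ≤?_) (All.map (λ q≤p c<q → c≮p (≤-trans c<q q≤p)) p≥)

    none : suc r ≤ count (suc c ≤?_) ps → suc c ≤ nth 0 (p ∷ ps) (suc r)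
    none q = contradiction (subst (suc r ≤_) count≡0 q) λ ()

    reject : ∀ r → suc c ≤ nth 0 (p ∷ ps) (suc r) → suc r ≤ count (suc c ≤?_) ps
    reject zero    c<p = contradiction c<p c≮p
    reject (suc r) q   = contradiction (subst (suc r ≤_) count≡0 (to (go ps s r) q)) λ ()

module _ (μ : Partition) where

  ∈-cells⁺ : ∀ {r c} → suc c ≤ nth 0 (parts μ) (suc r) → (suc r , suc c) ∈ cells μ
  ∈-cells⁺ {r} {c} c<λ with r <? length (parts μ)
  ... | yes r<ℓ = ∈-concat⁺′ (∈-map⁺ (suc r ,_) (∈-[1‥]⁺ c<λ)) (∈-map⁺ (row μ) (∈-[1‥]⁺ r<ℓ))
  ... | no  r≮ℓ = contradiction
    (subst (suc c ≤_) (nth-past (parts μ) r (≮⇒≥ r≮ℓ)) c<λ) λ ()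

  -- Matching on this view turns both coordinates into successors, the form in which `pred`, `nth`
  -- and `conjugate-⇔` can be applied.
  data CellView : Cell → Set where
    cell : ∀ r c → suc c ≤ nth 0 (parts μ) (suc r) → suc r ≤ length (parts μ) →
           CellView (suc r , suc c)

  ∈-cells⁻ : ∀ {z} → z ∈ cells μ → CellView z
  ∈-cells⁻ z∈
    with _ , z∈row , row∈ ← ∈-concat⁻′ (map (row μ) [1‥ length (parts μ) ]) z∈
    with r , r∈ , refl ← ∈-map⁻ (row μ) row∈
    with c , c∈ , refl ← ∈-map⁻ (r ,_) z∈row
    with s≤s {n = r} _ , r≤ ← ∈-[1‥]⁻ r∈ | s≤s {n = c} _ , c≤ ← ∈-[1‥]⁻ c∈
    = cell r c c≤ r≤

  ∈-cells-column : ∀ {r c} → suc r ≤ conjugate μ (suc c) → (suc r , suc c) ∈ cells μ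
  ∈-cells-column {r} {c} = ∈-cells⁺ ∘ from (conjugate-⇔ (parts μ) (decreasing μ) c r)

  ∈-cells-below : ∀ {r c} → (suc (suc r) , c) ∈ cells μ → (suc r , c) ∈ cells μ
  ∈-cells-below z∈ with cell _ c c< _ ← ∈-cells⁻ z∈ =
    ∈-cells-column (≤-trans (n≤1+n _) (to (conjugate-⇔ (parts μ) (decreasing μ) c _) c<))

  column : ℕ → List Cell
  column c = map (_, c) [1‥ conjugate μ c ]

  columns : List Cell
  columns = concat (map column [1‥ nth 0 (parts μ) 1 ])

  columns-unique : Unique columns
  columns-unique = Unique.concat⁺
    (All.map⁺ (All.universal (λ c → Unique.map⁺ ,-injectiveˡ ([1‥]-unique _)) _))
    (AllPairs.map⁺ (AllPairs.map disjoint ([1‥]-unique (nth 0 (parts μ) 1))))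
    where
    disjoint : ∀ {c d} → c ≢ d → ∀ {z} → ¬ (z ∈ column c × z ∈ column d)
    disjoint c≢d (z∈ , z∈′)
      with _ , _ , refl ← ∈-map⁻ (_, _) z∈ | _ , _ , refl ← ∈-map⁻ (_, _) z∈′ = c≢d refl

  -- `maj` is summed along rows but `cocharge` color by color, and the letters of one color are a
  -- column.
  cells↭columns : cells μ ↭ columns
  cells↭columns = unique-↭ (cells-unique μ) columns-unique ⊆ ⊇
    where
    ⊆ : ∀ {z} → z ∈ cells μ → z ∈ columns
    ⊆ z∈ with cell r c c< _ ← ∈-cells⁻ z∈ = ∈-concat⁺′
      (∈-map⁺ (_, suc c) (∈-[1‥]⁺ r<λ′))
      -- A nonempty column reaches row 1, so its index is at most the first part.
      (∈-map⁺ column (∈-[1‥]⁺ (from (conjugate-⇔ (parts μ) (decreasing μ) c 0)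
                                    (≤-trans (s≤s z≤n) r<λ′))))
      where
      r<λ′ : suc r ≤ conjugate μ (suc c)
      r<λ′ = to (conjugate-⇔ (parts μ) (decreasing μ) c r) c<

    ⊇ : ∀ {z} → z ∈ columns → z ∈ cells μ
    ⊇ z∈
      with _ , z∈col , col∈ ← ∈-concat⁻′ (map column [1‥ nth 0 (parts μ) 1 ]) z∈
      with c , c∈ , refl ← ∈-map⁻ column col∈
      with r , r∈ , refl ← ∈-map⁻ (_, c) z∈col
      with s≤s {n = r} _ , r≤ ← ∈-[1‥]⁻ r∈ | s≤s {n = c} _ , _ ← ∈-[1‥]⁻ c∈
      = ∈-cells-column r≤

-- Fillings as functions on cells

  fromEntries : (Cell → ℕ) → Filling
  fromEntries e = map (map e) (map (row μ) [1‥ length (parts μ) ])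

  concat-fromEntries : ∀ e → concat (fromEntries e) ≡ map e (cells μ)
  concat-fromEntries e = concat-map (map (row μ) [1‥ length (parts μ) ])

  fromEntries-cong : ∀ {e e′} → (∀ {z} → z ∈ cells μ → e z ≡ e′ z) →
                     fromEntries e ≡ fromEntries e′
  fromEntries-cong eq = map-cong-local (All.tabulate λ row∈ →
    map-cong-local (All.tabulate λ z∈ → eq (∈-concat⁺′ z∈ row∈)))

  fromEntries-shape : ∀ e → map length (fromEntries e) ≡ parts μ
  fromEntries-shape e = begin
    map length (map (map e) (map (row μ) [1‥ ℓ ])) ≡⟨ map-∘ (map (row μ) [1‥ ℓ ]) ⟨
    map (length ∘ map e) (map (row μ) [1‥ ℓ ])     ≡⟨ map-∘ [1‥ ℓ ] ⟨
    map (length ∘ map e ∘ row μ) [1‥ ℓ ]           ≡⟨ map-cong rowLength [1‥ ℓ ] ⟩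
    map (nth 0 (parts μ)) [1‥ ℓ ]                  ≡⟨ map-nth 0 (parts μ) ⟩
    parts μ ∎
    where
    open ≡-Reasoning
    ℓ = length (parts μ)

    rowLength : ∀ r → length (map e (row μ r)) ≡ nth 0 (parts μ) r
    rowLength r = begin
      length (map e (map (r ,_) [1‥ n ])) ≡⟨ length-map e (map (r ,_) [1‥ n ]) ⟩
      length (map (r ,_) [1‥ n ])         ≡⟨ length-map (r ,_) [1‥ n ] ⟩
      length (map suc (upTo n))           ≡⟨ length-map suc (upTo n) ⟩
      length (upTo n)                     ≡⟨ length-applyUpTo id n ⟩
      n ∎
      where n = nth 0 (parts μ) r

  entry-fromEntries : ∀ e {z} → z ∈ cells μ → entry (fromEntries e) z ≡ e z
  entry-fromEntries e z∈ with cell r c c< r< ← ∈-cells⁻ z∈ = begin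
    nth 0 (nth [] (fromEntries e) (suc r)) (suc c)
      ≡⟨ cong (λ xss → nth 0 (nth [] xss (suc r)) (suc c)) (map-∘ [1‥ ℓ ]) ⟨
    nth 0 (nth [] (map (map e ∘ row μ) [1‥ ℓ ]) (suc r)) (suc c)
      ≡⟨ cong (λ xs → nth 0 xs (suc c)) (nth-map-[1‥] [] (map e ∘ row μ) r<) ⟩
    nth 0 (map e (row μ (suc r))) (suc c)
      ≡⟨ cong (λ xs → nth 0 xs (suc c)) (map-∘ {g = e} [1‥ nth 0 (parts μ) (suc r) ]) ⟨
    nth 0 (map (λ c → e (suc r , c)) [1‥ nth 0 (parts μ) (suc r) ]) (suc c)
      ≡⟨ nth-map-[1‥] 0 (λ c → e (suc r , c)) c< ⟩
    e (suc r , suc c) ∎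
    where
    open ≡-Reasoning
    ℓ = length (parts μ)

  fromEntries-entry : ∀ {F} → map length F ≡ parts μ → fromEntries (entry F) ≡ F
  fromEntries-entry {F} shape≡ = begin
    map (map (entry F)) (map (row μ) [1‥ length (parts μ) ])
      ≡⟨ map-∘ [1‥ length (parts μ) ] ⟨
    map (map (entry F) ∘ row μ) [1‥ length (parts μ) ]
      ≡⟨ cong (λ n → map (map (entry F) ∘ row μ) [1‥ n ])
              (trans (cong length (sym shape≡)) (length-map length F)) ⟩
    map (map (entry F) ∘ row μ) [1‥ length F ]
      ≡⟨ map-cong rows [1‥ length F ] ⟩
    map (nth [] F) [1‥ length F ]
      ≡⟨ map-nth [] F ⟩
    F ∎
    where
    open ≡-Reasoning

    rows : ∀ r → map (entry F) (row μ r) ≡ nth [] F r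
    rows r = begin
      map (entry F) (map (r ,_) [1‥ nth 0 (parts μ) r ])
        ≡⟨ map-∘ [1‥ nth 0 (parts μ) r ] ⟨
      map (nth 0 (nth [] F r)) [1‥ nth 0 (parts μ) r ]
        ≡⟨ cong (λ n → map (nth 0 (nth [] F r)) [1‥ n ])
                (trans (cong (λ ps → nth 0 ps r) (sym shape≡)) (nth-map length [] F r)) ⟩
      map (nth 0 (nth [] F r)) [1‥ length (nth [] F r) ]
        ≡⟨ map-nth 0 (nth [] F r) ⟩
      nth [] F r ∎

  weight≡count : ∀ {F} → map length F ≡ parts μ → ∀ s →
                 weight F s ≡ count (λ z → s ≟ entry F z) (cells μ)
  weight≡count {F} shape≡ s = begin
    count (s ≟_) (concat F)
      ≡⟨ cong (count (s ≟_) ∘ concat) (fromEntries-entry shape≡) ⟨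
    count (s ≟_) (concat (fromEntries (entry F)))
      ≡⟨ cong (count (s ≟_)) (concat-fromEntries (entry F)) ⟩
    count (s ≟_) (map (entry F) (cells μ))
      ≡⟨ count≡∑ (s ≟_) (map (entry F) (cells μ)) ⟩
    sum (map (λ k → χ (s ≟ k)) (map (entry F) (cells μ)))
      ≡⟨ ∑-map _ (entry F) (cells μ) ⟩
    sum (map (λ z → χ (s ≟ entry F z)) (cells μ))
      ≡⟨ count≡∑ (λ z → s ≟ entry F z) (cells μ) ⟨
    count (λ z → s ≟ entry F z) (cells μ) ∎
    where open ≡-Reasoning

  entry>0 : ∀ {γ F} → IsFilling μ γ F → ∀ {z} → z ∈ cells μ → 0 < entry F z
  entry>0 {F = F} isF z∈ = All.lookup (All.concat⁺ (IsFilling.positive isF))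
    (subst (entry F _ ∈_)
      (trans (sym (concat-fromEntries (entry F)))
             (cong concat (fromEntries-entry (IsFilling.shape≡ isF))))
      (∈-map⁺ (entry F) z∈))

-- Placements and the cyclic order

≻-trans : ∀ {x y z} → x ≻ y → y ≻ z → x ≻ z
≻-trans (inj₁ p)          (inj₁ q)          = inj₁ (<-trans q p)
≻-trans (inj₁ p)          (inj₂ (refl , _)) = inj₁ p
≻-trans (inj₂ (refl , _)) (inj₁ q)          = inj₁ q
≻-trans (inj₂ (refl , p)) (inj₂ (refl , q)) = inj₂ (refl , <-trans p q)

≻-asym : Asymmetric _≻_
≻-asym (inj₁ p)          (inj₁ q)          = <-asym p q
≻-asym (inj₁ p)          (inj₂ (refl , _)) = <-irrefl refl p
≻-asym (inj₂ (refl , _)) (inj₁ q)          = <-irrefl refl q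
≻-asym (inj₂ (refl , p)) (inj₂ (refl , q)) = <-asym p q

-- The clockwise order from ⋆ of the letters, when e z is the sector of z.
Before : (Cell → ℕ) → Rel Cell _
Before e x y = e x < e y ⊎ (e x ≡ e y × x ≻ y)

Before-asym : ∀ e → Asymmetric (Before e)
Before-asym e (inj₁ p)       (inj₁ q)       = <-asym p q
Before-asym e (inj₁ p)       (inj₂ (eq , _)) = <-irrefl (sym eq) p
Before-asym e (inj₂ (eq , _)) (inj₁ q)       = <-irrefl (sym eq) q
Before-asym e (inj₂ (_ , p)) (inj₂ (_ , q)) = ≻-asym p q

-- InSectors e k C: the sectors of C are numbered from k on, and e z is the
-- number of the sector of z.
data InSectors (e : Cell → ℕ) : ℕ → Placement → Set where
  []  : ∀ {k} → InSectors e k []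
  _∷_ : ∀ {k zs C} → All (λ z → e z ≡ k) zs → InSectors e (suc k) C →
        InSectors e k (zs ∷ C)

InSectors-≥ : ∀ {e k C} → InSectors e k C → All (λ z → k ≤ e z) (concat C)
InSectors-≥ []       = []
InSectors-≥ (p ∷ ps) =
  All.++⁺ (All.map (≤-reflexive ∘ sym) p) (All.map (≤-trans (n≤1+n _)) (InSectors-≥ ps))

InSectors-cong : ∀ {e e′ k C} → (∀ {z} → z ∈ concat C → e z ≡ e′ z) →
                 InSectors e k C → InSectors e′ k C
InSectors-cong eq []                = []
InSectors-cong eq (_∷_ {zs = zs} p ps) =
  All.tabulate (λ z∈ → trans (sym (eq (∈-++⁺ˡ z∈))) (All.lookup p z∈)) ∷
  InSectors-cong (eq ∘ ∈-++⁺ʳ zs) ps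

InSectors-functional : ∀ {e e′ k C} → InSectors e k C → InSectors e′ k C →
                       ∀ {z} → z ∈ concat C → e z ≡ e′ z
InSectors-functional (_∷_ {zs = zs} p ps) (q ∷ qs) z∈ with ∈-++⁻ zs z∈
... | inj₁ z∈zs = trans (All.lookup p z∈zs) (sym (All.lookup q z∈zs))
... | inj₂ z∈C  = InSectors-functional ps qs z∈C

-- Between sectors the numbering decides; inside a sector all values of `e` tie and the prismatic
-- order decides.
InSectors-sorted : ∀ {e k C} → InSectors e k C → All (Linked _≻_) C →
                   AllPairs (Before e) (concat C)
InSectors-sorted []       []       = []
InSectors-sorted (p ∷ ps) (d ∷ ds) = AllPairs.++⁺
  (within p (Linked.Linked⇒AllPairs (λ {x y z} → ≻-trans {x} {y} {z}) d))
  (InSectors-sorted ps ds)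
  -- Once `k` is identified with `e z`, the bound `suc k ≤ e w` for a later letter `w` is literally
  -- `e z < e w`.
  (All.map (λ { refl → All.map inj₁ (InSectors-≥ ps) }) p)
  where
  within : ∀ {e k zs} → All (λ z → e z ≡ k) zs → AllPairs _≻_ zs → AllPairs (Before e) zs
  within []         []         = []
  within (eq ∷ eqs) (z≻ ∷ s) =
    All.zipWith (λ (eq′ , z≻w) → inj₂ (trans eq (sym eq′) , z≻w)) (eqs , z≻) ∷ within eqs s

InSectors-count : ∀ {e k C} → InSectors e k C → ∀ i →
                  count (λ z → (i + k) ≟ e z) (concat C) ≡ nth 0 (map length C) (suc i)
InSectors-count []                     i = refl
InSectors-count {e} {k} (_∷_ {zs = zs} {C = C} p ps) zero =
  trans (count-++ (λ z → k ≟ e z) zs (concat C))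
    (trans (cong₂ _+_ (count-all (λ z → k ≟ e z) (All.map sym p))
                      (count-none (λ z → k ≟ e z)
                        (All.map (λ k<e k≡e → <-irrefl k≡e k<e) (InSectors-≥ ps))))
           (+-identityʳ (length zs)))
InSectors-count {e} {k} (_∷_ {zs = zs} {C = C} p ps) (suc i) =
  trans (count-++ (λ z → suc i + k ≟ e z) zs (concat C))
    (trans (cong (_+ count (λ z → suc i + k ≟ e z) (concat C))
                 (count-none (λ z → suc i + k ≟ e z)
                   (All.map (λ e≡k i+k≡e → m≢1+n+m k (trans (sym e≡k) (sym i+k≡e))) p)))
           (subst (λ m → count (λ z → m ≟ e z) (concat C) ≡ nth 0 (map length C) (suc i))
                  (+-suc i k) (InSectors-count ps i)))

InSectors-applyUpTo : ∀ {e k} f n → (∀ i → All (λ z → e z ≡ i + k) (f i)) →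
                      InSectors e k (applyUpTo f n)
InSectors-applyUpTo f zero    p = []
InSectors-applyUpTo f (suc n) p = p 0 ∷ InSectors-applyUpTo (f ∘ suc) n λ i →
  All.map (λ eq → trans eq (sym (+-suc i _))) (p (suc i))

-- An absent letter gets the number just past the last sector. The value is thus at least `k` for
-- every cell, which makes the entries of the resulting filling positive without any membership
-- proof.
sectorFrom : ℕ → Placement → Cell → ℕ
sectorFrom k []       z = k
sectorFrom k (zs ∷ C) z = if does (z ∈? zs) then k else sectorFrom (suc k) C z

sectorFrom-≥ : ∀ k C z → k ≤ sectorFrom k C z
sectorFrom-≥ k []       z = ≤-refl
sectorFrom-≥ k (zs ∷ C) z with does (z ∈? zs)
... | true  = ≤-refl
... | false = ≤-trans (n≤1+n k) (sectorFrom-≥ (suc k) C z)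

-- The search stops at the first sector holding the letter; uniqueness makes it the only one.
InSectors-sectorFrom : ∀ k C → Unique (concat C) → InSectors (sectorFrom k C) k C
InSectors-sectorFrom k []       _ = []
InSectors-sectorFrom k (zs ∷ C) u =
  All.tabulate (λ {z} z∈ → cong (if_then k else sectorFrom (suc k) C z)
                                (dec-true (z ∈? zs) z∈)) ∷
  InSectors-cong later (InSectors-sectorFrom (suc k) C (unique-tail zs u))
  where
  unique-tail : ∀ (xs : List Cell) {ys} → Unique (xs ++ ys) → Unique ys
  unique-tail []       u       = u
  unique-tail (x ∷ xs) (_ ∷ u) = unique-tail xs u

  disjoint : ∀ {z} xs {ys : List Cell} → Unique (xs ++ ys) → z ∈ ys → z ∉ xs
  disjoint (x ∷ xs) (x∉ ∷ _) z∈ (here refl)  = All.lookup x∉ (∈-++⁺ʳ xs z∈) refl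
  disjoint (x ∷ xs) (_ ∷ u)  z∈ (there z∈′) = disjoint xs u z∈ z∈′

  later : ∀ {z} → z ∈ concat C → sectorFrom (suc k) C z ≡ sectorFrom k (zs ∷ C) z
  later {z} z∈ = sym (cong (if_then k else sectorFrom (suc k) C z)
                           (dec-false (z ∈? zs) (disjoint zs u z∈)))

-- The correspondence between fillings and circloids

module _ (μ : Partition) where

  -- The rows run from the highest index down, each from left to right, which is decreasing
  -- prismatic order. A filter keeps this order, so sectors cut out of the list are decreasing and
  -- nothing has to be sorted.
  prismatic : List Cell
  prismatic = concat (map (row μ) (applyDownFrom suc (length (parts μ))))

  prismatic-sorted : AllPairs _≻_ prismatic
  prismatic-sorted = AllPairs.concat⁺
    (All.map⁺ (All.universal row-sorted (applyDownFrom suc ℓ)))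
    (AllPairs.map⁺ (AllPairs.applyDownFrom⁺₁ suc ℓ (λ j<i _ → rows-sorted (s≤s j<i))))
    where
    ℓ = length (parts μ)

    row-sorted : ∀ r → AllPairs _≻_ (row μ r)
    row-sorted r = AllPairs.map⁺ {R = _≻_} {f = r ,_} (AllPairs.map⁺ {f = suc}
      (AllPairs.applyUpTo⁺₁ id (nth 0 (parts μ) r) λ i<j _ → inj₂ (refl , s≤s i<j)))

    rows-sorted : ∀ {r s} → s < r → All (λ y → All (y ≻_) (row μ s)) (row μ r)
    rows-sorted {r} {s} s<r =
      All.map⁺ (All.universal (λ _ → All.map⁺ (All.universal (λ _ → inj₁ s<r)
        [1‥ nth 0 (parts μ) s ])) [1‥ nth 0 (parts μ) r ])

  prismatic↭cells : prismatic ↭ cells μ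
  prismatic↭cells = unique-↭
    (sorted-unique (λ {x y} → ≻-asym {x} {y}) prismatic-sorted) (cells-unique μ) ⊆ ⊇
    where
    ℓ = length (parts μ)

    ⊆ : ∀ {z} → z ∈ prismatic → z ∈ cells μ
    ⊆ z∈
      with _ , z∈row , row∈ ← ∈-concat⁻′ (map (row μ) (applyDownFrom suc ℓ)) z∈
      with r , r∈ , refl ← ∈-map⁻ (row μ) row∈
      with i , i<ℓ , refl ← ∈-applyDownFrom⁻ suc r∈
      = ∈-concat⁺′ z∈row (∈-map⁺ (row μ) (∈-[1‥]⁺ i<ℓ))

    ⊇ : ∀ {z} → z ∈ cells μ → z ∈ prismatic
    ⊇ z∈ with cell r c c< r< ← ∈-cells⁻ μ z∈ =
      ∈-concat⁺′ (∈-map⁺ (suc r ,_) (∈-[1‥]⁺ c<))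
                 (∈-map⁺ (row μ) (∈-applyDownFrom⁺ suc r<))

  circloid↭cells : ∀ {γ C} → IsCircloid μ γ C → concat C ↭ cells μ
  circloid↭cells {γ} {C} (mkIsCircloid _ letters once _) =
    unique-↭ (count≡1⇒unique _≟ᶜ_ (concat C) (All.lookup once ∘ ⊆)) (cells-unique μ) ⊆ ⊇
    where
    ⊆ : ∀ {z} → z ∈ concat C → z ∈ cells μ
    ⊆ = All.lookup (All.concat⁺ letters)

    ⊇ : ∀ {z} → z ∈ cells μ → z ∈ concat C
    ⊇ {z} z∈ with filter (z ≟ᶜ_) (concat C) in eq | All.lookup once z∈
    -- A count of 1 leaves only the nonempty case, and the head of the filtered list is `z` itself.
    ... | w ∷ _ | _
      with w∈ , refl ← ∈-filter⁻ (z ≟ᶜ_) {xs = concat C} (subst (w ∈_) (sym eq) (here refl))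
      = w∈

  circloid-of-filling : ∀ {γ F} → IsFilling μ γ F →
              ∃ λ C → IsCircloid μ γ C × InSectors (entry F) 1 C
  circloid-of-filling {γ} {F} isF =
    C , mkIsCircloid shape letters once decr , inSectors
    where
    open IsFilling isF
    open ≡-Reasoning

    sector : ℕ → List Cell
    sector i = filter (λ z → suc i ≟ entry F z) prismatic

    C = applyUpTo sector (length γ)

    inSectors : InSectors (entry F) 1 C
    inSectors = InSectors-applyUpTo sector (length γ) λ i →
      All.map (λ eq → trans (sym eq) (sym (+-comm i 1))) (All.all-filter _ prismatic)

    decr : All (Linked _≻_) C
    decr = All.applyUpTo⁺₂ sector (length γ) λ i →
      Linked.AllPairs⇒Linked (AllPairs.filter⁺ _ prismatic-sorted)

    sectorLength : ∀ i → length (sector i) ≡ nth 0 γ (suc i)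
    sectorLength i = begin
      length (sector i)
        ≡⟨ ↭.↭-length (↭.filter-↭ (λ z → suc i ≟ entry F z) prismatic↭cells) ⟩
      count (λ z → suc i ≟ entry F z) (cells μ)
        ≡⟨ weight≡count μ shape≡ (suc i) ⟨
      weight F (suc i)
        ≡⟨ weight≡ i ⟩
      nth 0 γ (suc i) ∎

    shape : map length C ≡ γ
    shape = begin
      map length C                                ≡⟨ map-applyUpTo sector length (length γ) ⟩
      applyUpTo (length ∘ sector) (length γ)      ≡⟨ map-upTo (length ∘ sector) (length γ) ⟨
      map (length ∘ sector) (upTo (length γ))     ≡⟨ map-cong sectorLength (upTo (length γ)) ⟩
      map (nth 0 γ ∘ suc) (upTo (length γ))       ≡⟨ map-upTo (nth 0 γ ∘ suc) (length γ) ⟩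
      applyUpTo (nth 0 γ ∘ suc) (length γ)        ≡⟨ applyUpTo-nth 0 γ ⟩
      γ ∎

    letters : All (All (_∈ cells μ)) C
    letters = All.applyUpTo⁺₂ sector (length γ) λ i → All.tabulate λ z∈ →
      ↭.∈-resp-↭ prismatic↭cells (proj₁ (∈-filter⁻ _ {xs = prismatic} z∈))

    -- An entry beyond `length γ` would have weight 0 although its own cell is counted; so every
    -- cell falls into one of the sectors of `C`.
    entry-bounded : ∀ {z} → z ∈ cells μ → ∃ λ i → i < length γ × suc i ≡ entry F z
    entry-bounded {z} z∈ with entry F z in eq | entry>0 μ isF z∈
    ... | suc i | _ with i <? length γ
    ...   | yes i< = i , i< , refl
    ...   | no  i≮ = contradiction
      (trans (sym (weight≡count μ shape≡ (suc i)))
             (trans (weight≡ i) (nth-past γ i (≮⇒≥ i≮))))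
      (nonempty (∈-filter⁺ (λ z → suc i ≟ entry F z) z∈ (sym eq)))
      where
      nonempty : ∀ {z : Cell} {zs} → z ∈ zs → length zs ≢ 0
      nonempty (here _)  ()
      nonempty (there _) ()

    once : All (λ z → count (z ≟ᶜ_) (concat C) ≡ 1) (cells μ)
    once = All.tabulate λ z∈ →
      let i , i< , eq = entry-bounded z∈ in
      unique⇒count≡1 _≟ᶜ_
        (sorted-unique (λ {x y} → Before-asym (entry F) {x} {y}) (InSectors-sorted inSectors decr))
        (∈-concat⁺′ (∈-filter⁺ _ (↭.∈-resp-↭ (↭.↭-sym prismatic↭cells) z∈) eq)
                    (∈-applyUpTo⁺ sector i<))

  filling-of-circloid : ∀ {γ C} → IsCircloid μ γ C →
            ∃ λ F → IsFilling μ γ F × InSectors (entry F) 1 C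
  filling-of-circloid {γ} {C} isC =
    F , mkIsFilling (fromEntries-shape μ e) pos wt , inSectors
    where
    e = sectorFrom 1 C
    F = fromEntries μ e
    perm = circloid↭cells isC
    open ≡-Reasoning

    inSectors : InSectors (entry F) 1 C
    inSectors = InSectors-cong (λ z∈ → sym (entry-fromEntries μ e (↭.∈-resp-↭ perm z∈)))
      (InSectors-sectorFrom 1 C (count≡1⇒unique _≟ᶜ_ (concat C)
        (All.lookup (IsCircloid.once isC) ∘ ↭.∈-resp-↭ perm)))

    pos : All (All (0 <_)) F
    pos = All.map⁺ (All.universal (λ zs → All.map⁺ (All.universal (sectorFrom-≥ 1 C) zs)) _)

    wt : ∀ i → weight F (suc i) ≡ nth 0 γ (suc i)
    wt i = begin
      weight F (suc i)
        ≡⟨ weight≡count μ (fromEntries-shape μ e) (suc i) ⟩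
      count (λ z → suc i ≟ entry F z) (cells μ)
        ≡⟨ ↭.↭-length (↭.filter-↭ (λ z → suc i ≟ entry F z) perm) ⟨
      count (λ z → suc i ≟ entry F z) (concat C)
        ≡⟨ cong (λ m → count (λ z → m ≟ entry F z) (concat C)) (+-comm 1 i) ⟩
      count (λ z → i + 1 ≟ entry F z) (concat C)
        ≡⟨ InSectors-count inSectors i ⟩
      nth 0 (map length C) (suc i)
        ≡⟨ cong (λ ns → nth 0 ns (suc i)) (IsCircloid.shape≡ isC) ⟩
      nth 0 γ (suc i) ∎

  filling-unique : ∀ {γ F F′ C} → IsFilling μ γ F → IsFilling μ γ F′ → IsCircloid μ γ C →
                   InSectors (entry F) 1 C → InSectors (entry F′) 1 C → F ≡ F′
  filling-unique isF isF′ isC s s′ = trans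
    (sym (fromEntries-entry μ (IsFilling.shape≡ isF)))
    (trans (fromEntries-cong μ λ z∈ → InSectors-functional s s′
             (↭.∈-resp-↭ (↭.↭-sym (circloid↭cells isC)) z∈))
           (fromEntries-entry μ (IsFilling.shape≡ isF′)))

  -- Both circles read from ⋆ are lists of all cells sorted by `Before e`, hence equal, and the
  -- common shape cuts them in the same places.
  circloid-unique : ∀ {γ C C′} e → IsCircloid μ γ C → IsCircloid μ γ C′ →
                     InSectors e 1 C → InSectors e 1 C′ → C ≡ C′
  circloid-unique {C = C} {C′} e isC isC′ s s′ = concat-injective C C′
    (trans (IsCircloid.shape≡ isC) (sym (IsCircloid.shape≡ isC′)))
    (sorted-≡ (λ {x y} → Before-asym e {x} {y})
      (InSectors-sorted s (IsCircloid.decreasing isC))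
      (InSectors-sorted s′ (IsCircloid.decreasing isC′))
      (↭.∈-resp-↭ (↭.trans perm (↭.↭-sym perm′)))
      (↭.∈-resp-↭ (↭.trans perm′ (↭.↭-sym perm))))
    where
    perm  = circloid↭cells isC
    perm′ = circloid↭cells isC′

-- The statistics

-- The hypotheses say that the points pu, pv, pw are ordered like the entries
-- u, v, w, ties being broken as pu < pw < pv.
inversion⇔passed : ∀ {u v w pu pv pw} →
  (u ≤ w → pu < pw) → (w < u → pw < pu) →
  (u ≤ v → pu < pv) → (v < u → pv < pu) →
  (w ≤ v → pw < pv) → (v < w → pv < pw) →
  IsInversion u v w ⇔ Passed pv pw pu
inversion⇔passed {u} {v} {w} {pu} {pv} {pw} u≤w⇒ w<u⇒ u≤v⇒ v<u⇒ w≤v⇒ v<w⇒ = mk⇔ ⇒ ⇐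
  where
  ⇒ : IsInversion u v w → Passed pv pw pu
  -- The tie puts `pu` before `pv`, so the arc from `pv` to `pu` crosses ⋆. It misses only the
  -- points between `pu` and `pv`, and an entry different from `u` and `v` cannot lie there.
  ⇒ (inj₁ (refl , u≢w)) with <-cmp u w
  ... | tri< u<w _ _ = inj₂ (u≤v⇒ ≤-refl , inj₁ (v<w⇒ u<w))
  ... | tri≈ _ u≡w _ = contradiction u≡w u≢w
  ... | tri> _ _ w<u = inj₂ (u≤v⇒ ≤-refl , inj₂ (w<u⇒ w<u))
  ⇒ (inj₂ (inj₁ (w<u , v<w)))        = inj₁ (v<w⇒ v<w , w<u⇒ w<u)
  ⇒ (inj₂ (inj₂ (inj₁ (v<w , u<v)))) = inj₂ (u≤v⇒ (<⇒≤ u<v) , inj₁ (v<w⇒ v<w))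
  ⇒ (inj₂ (inj₂ (inj₂ (u<v , w<u)))) = inj₂ (u≤v⇒ (<⇒≤ u<v) , inj₂ (w<u⇒ w<u))

  reflect : ∀ {i j p q} → (j ≤ i → q < p) → p < q → i < j
  reflect j≤i⇒ p<q = ≰⇒> λ j≤i → <-asym p<q (j≤i⇒ j≤i)

  v<w⇐ : pv < pw → v < w
  v<w⇐ = reflect w≤v⇒

  w<u⇐ : pw < pu → w < u
  w<u⇐ = reflect u≤w⇒

  u≤v⇐ : pu < pv → u ≤ v
  u≤v⇐ pu<pv = ≮⇒≥ λ v<u → <-asym pu<pv (v<u⇒ v<u)

  ⇐ : Passed pv pw pu → IsInversion u v w
  ⇐ (inj₁ (pv<pw , pw<pu)) = inj₂ (inj₁ (w<u⇐ pw<pu , v<w⇐ pv<pw))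
  -- `pu < pv` gives only `u ≤ v`: strict inequality leads to the last two patterns, equality to the
  -- first.
  ⇐ (inj₂ (pu<pv , w∉)) with m≤n⇒m<n∨m≡n (u≤v⇐ pu<pv) | w∉
  ... | inj₁ u<v  | inj₁ pv<pw = inj₂ (inj₂ (inj₁ (v<w⇐ pv<pw , u<v)))
  ... | inj₁ u<v  | inj₂ pw<pu = inj₂ (inj₂ (inj₂ (u<v , w<u⇐ pw<pu)))
  ... | inj₂ refl | inj₁ pv<pw = inj₁ (refl , λ v≡w → <-irrefl v≡w (v<w⇐ pv<pw))
  ... | inj₂ refl | inj₂ pw<pu = inj₁ (refl , λ v≡w → <-irrefl (sym v≡w) (w<u⇐ pw<pu))

module _ {μ γ F C} (isF : IsFilling μ γ F) (isC : IsCircloid μ γ C)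
         (inSectors : InSectors (entry F) 1 C) where

  private
    sorted : AllPairs (Before (entry F)) (concat C)
    sorted = InSectors-sorted inSectors (IsCircloid.decreasing isC)

    perm : concat C ↭ cells μ
    perm = circloid↭cells μ isC

    ∈C : ∀ {z} → z ∈ cells μ → z ∈ concat C
    ∈C = ↭.∈-resp-↭ (↭.↭-sym perm)

    pos : Cell → ℕ
    pos z = position _≟ᶜ_ z (concat C)

    pos-mono : ∀ {y z} → y ∈ cells μ → z ∈ cells μ → Before (entry F) y z → pos y < pos z
    pos-mono y∈ z∈ = position-mono (λ {x y} → Before-asym (entry F) {x} {y})
                                   _≟ᶜ_ sorted (∈C y∈) (∈C z∈)

    pos-< : ∀ {y z} → y ∈ cells μ → z ∈ cells μ → entry F y < entry F z → pos y < pos z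
    pos-< y∈ z∈ = pos-mono y∈ z∈ ∘ inj₁

    ≤⇒Before : ∀ {y z} → y ≻ z → entry F y ≤ entry F z → Before (entry F) y z
    ≤⇒Before y≻z ≤ with m≤n⇒m<n∨m≡n ≤
    ... | inj₁ lt = inj₁ lt
    ... | inj₂ eq = inj₂ (eq , y≻z)

    pos-≤ : ∀ {y z} → y ∈ cells μ → z ∈ cells μ → y ≻ z → entry F y ≤ entry F z → pos y < pos z
    pos-≤ y∈ z∈ y≻z = pos-mono y∈ z∈ ∘ ≤⇒Before y≻z

  triple⇔betrays : ∀ {y z} → y ∈ cells μ → z ∈ cells μ →
                   IsInversionTriple F (y , z) ⇔ Betrays C y z
  triple⇔betrays y∈ z∈ = mk⇔
    (λ { (refl , c<d , inv) → refl , c<d , to (inversion y∈ z∈ c<d) inv })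
    (λ { (refl , c<d , passed) → refl , c<d , from (inversion y∈ z∈ c<d) passed })
    where
    inversion : ∀ {r c d} → (r , c) ∈ cells μ → (r , d) ∈ cells μ → c < d →
                IsInversion (entry F (r , c)) (entry F (pred r , c)) (entry F (r , d)) ⇔
                Passed (positionIn C (pred r , c)) (positionIn C (r , d)) (positionIn C (r , c))
    inversion {c = c} y∈ z∈ c<d with ∈-cells⁻ μ y∈
    -- In the bottom row `v` reduces to 0 and `pv` is the position 0 of ⋆. Entries are positive, so
    -- the cases `u ≤ v` and `w ≤ v` are void, and every letter lies after ⋆.
    ... | cell zero    c _ _ rewrite nth-0 [] F = inversion⇔passed
      (pos-≤ y∈ z∈ (inj₂ (refl , c<d))) (pos-< z∈ y∈)
      (λ u≤0 → contradiction (≤-trans (entry>0 μ isF y∈) u≤0) λ ())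
      (λ _ → position>0 _≟ᶜ_ _ (concat C))
      (λ w≤0 → contradiction (≤-trans (entry>0 μ isF z∈) w≤0) λ ())
      (λ _ → position>0 _≟ᶜ_ _ (concat C))
    -- Among equal entries the color decides between the two cells of the row, and both precede the
    -- cell below because their letter is larger.
    ... | cell (suc r) c _ _ = inversion⇔passed
      (pos-≤ y∈ z∈ (inj₂ (refl , c<d))) (pos-< z∈ y∈)
      (pos-≤ y∈ x∈ (inj₁ ≤-refl)) (pos-< x∈ y∈)
      (pos-≤ z∈ x∈ (inj₁ ≤-refl)) (pos-< x∈ z∈)
      where
      x∈ = ∈-cells-below μ y∈

  inv≡betrayal : inv μ F ≡ betrayal C
  inv≡betrayal = begin
    inv μ F
      ≡⟨ count≡∑ (isInversionTriple? F) (cartesianProduct (cells μ) (cells μ)) ⟩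
    sum (map (λ yz → χ (isInversionTriple? F yz)) (cartesianProduct (cells μ) (cells μ)))
      ≡⟨ ∑-cartesianProduct (λ yz → χ (isInversionTriple? F yz)) (cells μ) (cells μ) ⟩
    sum (map (λ y → sum (map (λ z → χ (isInversionTriple? F (y , z))) (cells μ))) (cells μ))
      ≡⟨ ∑-cong (cells μ) betrayals ⟩
    sum (map (λ y → count (betrays? C y) (concat C)) (cells μ))
      ≡⟨ ∑-↭ (λ y → count (betrays? C y) (concat C)) perm ⟨
    betrayal C ∎
    where
    open ≡-Reasoning

    betrayals : ∀ {y} → y ∈ cells μ →
                sum (map (λ z → χ (isInversionTriple? F (y , z))) (cells μ)) ≡
                count (betrays? C y) (concat C)
    betrayals {y} y∈ = begin
      sum (map (λ z → χ (isInversionTriple? F (y , z))) (cells μ))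
        ≡⟨ ∑-cong (cells μ) (λ {z} z∈ →
             χ-cong (triple⇔betrays y∈ z∈) (isInversionTriple? F (y , z)) (betrays? C y z)) ⟩
      sum (map (λ z → χ (betrays? C y z)) (cells μ))
        ≡⟨ ∑-↭ (λ z → χ (betrays? C y z)) perm ⟨
      sum (map (λ z → χ (betrays? C y z)) (concat C))
        ≡⟨ count≡∑ (betrays? C y) (concat C) ⟨
      count (betrays? C y) (concat C) ∎

  private
    majTerm : Cell → ℕ
    majTerm (r , c) = χ (isDescent? F (r , c)) * (conjugate μ c + 1 ∸ r)

  -- The label of a letter counts the descents in the column up to that letter. Summation by parts
  -- therefore counts a descent in row `suc i` once for each of the letters `suc i`, ..., `m`, that
  -- is `m ∸ i` times, which is its weight in `maj`.
  cochargeʷ≡∑ : ∀ c → cochargeʷ (colorWord C (suc c)) ≡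
                      sum (map majTerm (column μ (suc c)))
  cochargeʷ≡∑ c₀ = begin
    sum (map (label w) w)
      ≡⟨ ∑-↭ (label w) (↭.trans (↭.↭-reverse L) L↭) ⟩
    sum (map (label w) [1‥ m ])
      ≡⟨ cong sum (map-[1‥] (label w) m) ⟩
    sum (applyUpTo (label w ∘ suc) m)
      ≡⟨ ∑-partial-sums (label w ∘ suc) δ 0 m refl (λ _ → refl) ⟩
    m * 0 + sum (applyUpTo (λ i → δ i * (m ∸ i)) m)
      ≡⟨ cong (_+ sum (applyUpTo (λ i → δ i * (m ∸ i)) m)) (*-zeroʳ m) ⟩
    sum (applyUpTo (λ i → δ i * (m ∸ i)) m)
      ≡⟨ cong sum (map-upTo (λ i → δ i * (m ∸ i)) m) ⟨
    sum (map (λ i → δ i * (m ∸ i)) (upTo m))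
      ≡⟨ ∑-cong (upTo m) (term ∘ ∈-upTo⁻) ⟩
    sum (map (λ i → majTerm (suc i , c)) (upTo m))
      ≡⟨ ∑-map (λ r → majTerm (r , c)) suc (upTo m) ⟨
    sum (map (λ r → majTerm (r , c)) [1‥ m ])
      ≡⟨ ∑-map majTerm (_, c) [1‥ m ] ⟨
    sum (map majTerm (column μ c)) ∎
    where
    open ≡-Reasoning
    c = suc c₀
    m = conjugate μ c
    ofColor = filter (λ z → proj₂ z ≟ c) (concat C)
    L = map proj₁ ofColor
    w = colorWord C c

    _≺_ : Rel ℕ _
    x ≺ y = Before (entry F) (x , c) (y , c)

    ≺-asym : Asymmetric _≺_
    ≺-asym {x} {y} = Before-asym (entry F) {x , c} {y , c}

    -- Restoring the color recovers a sublist of the circle, so the bare letters inherit its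
    -- sorting.
    ofColor≡ : map (_, c) L ≡ ofColor
    ofColor≡ = trans (sym (map-∘ ofColor))
      (map-id-local (All.map (λ { refl → refl }) (All.all-filter (λ z → proj₂ z ≟ c) (concat C))))

    L-sorted : AllPairs _≺_ L
    L-sorted = AllPairs.map⁻ (subst (AllPairs (Before (entry F))) (sym ofColor≡)
      (AllPairs.filter⁺ (λ z → proj₂ z ≟ c) sorted))

    ∈L⁺ : ∀ {x} → (x , c) ∈ cells μ → x ∈ L
    ∈L⁺ z∈ = ∈-map⁺ proj₁ (∈-filter⁺ (λ z → proj₂ z ≟ c) (∈C z∈) refl)

    ∈L⁻ : ∀ {x} → x ∈ L → (x , c) ∈ cells μ
    ∈L⁻ x∈
      with _ , z∈ , refl ← ∈-map⁻ proj₁ x∈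
      with z∈C , refl ← ∈-filter⁻ (λ z → proj₂ z ≟ c) {xs = concat C} z∈
      = ↭.∈-resp-↭ perm z∈C

    L↭ : L ↭ [1‥ m ]
    L↭ = unique-↭ (sorted-unique (λ {x y} → ≺-asym {x} {y}) L-sorted) ([1‥]-unique m) ⊆ ⊇
      where
      ⊆ : ∀ {x} → x ∈ L → x ∈ [1‥ m ]
      ⊆ x∈ with cell r _ c< _ ← ∈-cells⁻ μ (∈L⁻ x∈) =
        ∈-[1‥]⁺ (to (conjugate-⇔ (parts μ) (decreasing μ) c₀ r) c<)

      ⊇ : ∀ {x} → x ∈ [1‥ m ] → x ∈ L
      ⊇ x∈ with s≤s _ , x≤m ← ∈-[1‥]⁻ x∈ = ∈L⁺ (∈-cells-column μ x≤m)

    passed⋆? : ∀ i → Dec (Passed (position _≟_ (suc i) (reverse w)) 0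
                                 (position _≟_ (suc (suc i)) (reverse w)))
    passed⋆? i = passed? (position _≟_ (suc i) (reverse w)) 0
                         (position _≟_ (suc (suc i)) (reverse w))

    δ : ℕ → ℕ
    δ zero    = 0
    δ (suc i) = if does (passed⋆? i) then 0 else 1

    δ≡χ : ∀ i → suc i < m → δ (suc i) ≡ χ (isDescent? F (suc (suc i) , c))
    δ≡χ i i+1<m = if-not (passed⋆? i) (isDescent? F (suc (suc i) , c)) descent ascent
      where
      upper∈ : (suc (suc i) , c) ∈ cells μ
      upper∈ = ∈-cells-column μ i+1<m

      lower∈ : (suc i , c) ∈ cells μ
      lower∈ = ∈-cells-below μ upper∈

      mono : ∀ {x y} → (x , c) ∈ cells μ → (y , c) ∈ cells μ → x ≺ y →
             position _≟_ x (reverse w) < position _≟_ y (reverse w)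
      mono {x} {y} x∈ y∈ x≺y =
        subst (λ xs → position _≟_ x xs < position _≟_ y xs) (sym (reverse-involutive L))
          (position-mono (λ {x y} → ≺-asym {x} {y}) _≟_ L-sorted (∈L⁺ x∈) (∈L⁺ y∈) x≺y)

      descent : IsDescent F (suc (suc i) , c) → ¬ Passed _ 0 _
      descent (_ , lt) (inj₁ (() , _))
      descent (_ , lt) (inj₂ (gt , _)) = <-asym gt (mono lower∈ upper∈ (inj₁ lt))

      -- Without a descent the upper entry is at most the lower one, so the upper letter comes first
      -- even on a tie. The reading then wraps around and crosses ⋆, whose position 0 is below that
      -- of any letter.
      ascent : ¬ IsDescent F (suc (suc i) , c) → Passed _ 0 _
      ascent ¬lt = inj₂
        ( mono upper∈ lower∈ (≤⇒Before (inj₁ ≤-refl) (≮⇒≥ λ lt → ¬lt (s≤s (s≤s z≤n) , lt)))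
        , inj₂ (position>0 _≟_ _ (reverse w)))

    term : ∀ {i} → i < m → δ i * (m ∸ i) ≡ majTerm (suc i , c)
    -- Both sides vanish by computation: the letter 1 has label 0, and the descent test fails in row
    -- 1.
    term {zero}  _     = refl
    term {suc i} i+1<m = cong₂ _*_ (δ≡χ i i+1<m)
      (cong (_∸ suc (suc i)) (+-comm 1 m))

  maj≡cocharge : maj μ F ≡ cocharge μ C
  maj≡cocharge = begin
    maj μ F
      ≡⟨ ∑-filter (isDescent? F) (λ (r , c) → conjugate μ c + 1 ∸ r) (cells μ) ⟩
    sum (map majTerm (cells μ))
      ≡⟨ ∑-↭ majTerm (cells↭columns μ) ⟩
    sum (map majTerm (columns μ))
      ≡⟨ ∑-concat majTerm (map (column μ) [1‥ λ₁ ]) ⟩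
    sum (map (λ zs → sum (map majTerm zs)) (map (column μ) [1‥ λ₁ ]))
      ≡⟨ ∑-map (λ zs → sum (map majTerm zs)) (column μ) [1‥ λ₁ ] ⟩
    sum (map (λ c → sum (map majTerm (column μ c))) [1‥ λ₁ ])
      ≡⟨ ∑-map (λ c → sum (map majTerm (column μ c))) suc (upTo λ₁) ⟩
    sum (map (λ c → sum (map majTerm (column μ (suc c)))) (upTo λ₁))
      ≡⟨ ∑-cong (upTo λ₁) (λ {c} _ → sym (cochargeʷ≡∑ c)) ⟩
    sum (map (λ c → cochargeʷ (colorWord C (suc c))) (upTo λ₁))
      ≡⟨ ∑-map (λ c → cochargeʷ (colorWord C c)) suc (upTo λ₁) ⟨
    cocharge μ C ∎
    where
    open ≡-Reasoning
    λ₁ = nth 0 (parts μ) 1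

-- Comparison of coefficients

theorem12 : (μ : Partition) → H̃ μ ≋ circloidSeries μ
-- Both coefficients are lengths of duplicate-free lists, and the same relation read in either
-- direction gives the two inequalities.
theorem12 μ γ i j = ≤-antisym
  (length-≤ (λ F C → InSectors (entry F) 1 C)
    (Unique.filter⁺ F-stats? (fillings-unique μ γ))
    toCircloid
    (λ F∈ F′∈ C∈ → filling-unique μ (isFilling F∈) (isFilling F′∈) (isCircloid C∈)))
  (length-≤ (λ C F → InSectors (entry F) 1 C)
    (Unique.filter⁺ C-stats? (circloids-unique μ γ))
    toFilling
    (λ {_} {_} {F} C∈ C′∈ _ → circloid-unique μ (entry F) (isCircloid C∈) (isCircloid C′∈)))
  where
  F-stats? : Decidable (λ F → inv μ F ≡ i × maj μ F ≡ j)
  F-stats? F = (inv μ F ≟ i) ×-dec (maj μ F ≟ j)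

  C-stats? : Decidable (λ C → betrayal C ≡ i × cocharge μ C ≡ j)
  C-stats? C = (betrayal C ≟ i) ×-dec (cocharge μ C ≟ j)

  Fs = filter F-stats? (fillings μ γ)
  Cs = filter C-stats? (circloids μ γ)

  isFilling : ∀ {F} → F ∈ Fs → IsFilling μ γ F
  isFilling F∈ = to ∈-fillings (proj₁ (∈-filter⁻ F-stats? {xs = fillings μ γ} F∈))

  isCircloid : ∀ {C} → C ∈ Cs → IsCircloid μ γ C
  isCircloid C∈ = to ∈-circloids (proj₁ (∈-filter⁻ C-stats? {xs = circloids μ γ} C∈))

  toCircloid : ∀ {F} → F ∈ Fs → ∃ λ C → C ∈ Cs × InSectors (entry F) 1 C
  toCircloid F∈
    with _ , inv≡ , maj≡ ← ∈-filter⁻ F-stats? {xs = fillings μ γ} F∈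
    with C , isC , s ← circloid-of-filling μ (isFilling F∈)
    = C , ∈-filter⁺ C-stats? (from ∈-circloids isC)
            ( trans (sym (inv≡betrayal (isFilling F∈) isC s)) inv≡
            , trans (sym (maj≡cocharge (isFilling F∈) isC s)) maj≡) , s

  toFilling : ∀ {C} → C ∈ Cs → ∃ λ F → F ∈ Fs × InSectors (entry F) 1 C
  toFilling C∈
    with _ , betrayal≡ , cocharge≡ ← ∈-filter⁻ C-stats? {xs = circloids μ γ} C∈
    with F , isF , s ← filling-of-circloid μ (isCircloid C∈)
    = F , ∈-filter⁺ F-stats? (from ∈-fillings isF)
            ( trans (inv≡betrayal isF (isCircloid C∈) s) betrayal≡
            , trans (maj≡cocharge isF (isCircloid C∈) s) cocharge≡) , s
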